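{- Consider an equation system $X=_\mu F$ where $F$ is a quantitative formula possibly containing $\min$. Suppose there are $u\in\mathbb{E}(D)$ with $[\![F^{\max}]\!](u)\le u$, a function $r\colon D\to[0,\infty)$ with $[\![\mathsf{D}(F^{\max})]\!](r)+u\le r$, and $\eta\in\mathbb{E}(D)$ with $\eta\le u$ and $[\![F]\!](\eta)\ge\eta$. Then $\eta$ is a lower bound of the least fixed point of $[\![F]\!]$, i.e. $\eta\le\mu[\![F]\!]$.
   Context: $\mathbb{E}(D)$ is the set of functions $D\to[0,\infty]$ with pointwise order and operations ($\infty+x=\infty$, $0\cdot\infty=0$, $r\cdot\infty=\infty$ for $r>0$). Quantitative formulas over a predicate variable $X$ (of type $D\to\Omega$) with minimum are: $F ::= X(\tilde e)\mid t\mid F_1+F_2\mid t\cdot F\mid \mathbf{if}\ \varphi\ \mathbf{then}\ F_1\ \mathbf{else}\ F_2\mid\min\{F_1,\dots,F_n\}$, with $\tilde e$ expressions, $t$ a $[0,\infty)$-valued term, $\varphi$ boolean; interpreted as maps $\mathbb{E}(D)\to\mathbb{E}(D)$ by $[\![X(e)]\!](\eta)(v)=\eta([\![e]\!](v))$, $[\![t]\!](\eta)(v)=[\![t]\!](v)$, pointwise sum and scalar product, case distinction for conditionals, and pointwise minimum for $\min$. $F^{\max}$ is obtained from $F$ by replacing every $\min$ by $\max$ (interpreted as pointwise maximum). $\mathsf{D}F$ is defined syntactically: $\mathsf{D}(X(\tilde e))=X(\tilde e)$, $\mathsf{D}t=0$, $\mathsf{D}(F_1+F_2)=\mathsf{D}F_1+\mathsf{D}F_2$,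 $\mathsf{D}(t\cdot F)=t\cdot\mathsf{D}F$, $\mathsf{D}(\mathbf{if}\ \varphi\ \mathbf{then}\ F_1\ \mathbf{else}\ F_2)=\mathbf{if}\ \varphi\ \mathbf{then}\ \mathsf{D}F_1\ \mathbf{else}\ \mathsf{D}F_2$, $\mathsf{D}(\min\{F_1,\dots,F_n\})=\min\{\mathsf{D}F_1,\dots,\mathsf{D}F_n\}$ (and likewise for $\max$). -}

module Defs where

open import Data.Bool using (Bool; true; false; if_then_else_)
open import Data.Fin using (Fin; zero; suc)
open import Data.Nat as ℕ using (ℕ; zero; suc; z≤n; s≤s)
import Data.Nat.Properties as ℕ
open import Data.Product using (∃; ∃₂; _×_; _,_; proj₁; proj₂)
open import Data.Rational using (ℚ; 0ℚ; 1ℚ; _<_; _+_; _*_; -_; positive; 1/_)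
open import Data.Rational.Properties using
  ( <-trans; <-dense; <-irrefl; <-cmp; _<?_; positive⁻¹; +-comm; +-assoc; +-identityʳ
  ; +-inverseˡ; +-inverseʳ; +-monoʳ-<; +-monoˡ-<; *-assoc; *-identityˡ; *-identityʳ
  ; *-inverseʳ; pos⇒nonZero; 1/pos⇒pos; pos*pos⇒pos )
open import Data.Sum using (_⊎_; inj₁; inj₂)
open import Data.Unit using (⊤; tt)
open import Data.Vec.Functional using (Vector)
open import Function using (_∘_)
open import Level using (Level; 0ℓ; _⊔_) renaming (suc to lsuc)
open import Relation.Binary.Definitions using (tri<; tri≈; tri>)
open import Relation.Binary.PropositionalEquality using (_≡_; refl; sym; subst; cong; trans)
open import Relation.Nullary.Decidable using (toWitness)
open import Relation.Nullary.Negation using (contradiction)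
open import Relation.Unary using (Pred; _∈_; _∉_; _⊆_; _∩_; _∪_)

private
  variable
    ℓ : Level
    n : ℕ

-- The extended half-line [0,∞]: x is given by its open lower cut
-- { q ∈ ℚ | q < x }.  The cut is all of ℚ exactly for x = ∞, so no case
-- distinction on finiteness is needed in the operations below.

record ℝ≥0∞ : Set₁ where
  field
    cut      : Pred ℚ 0ℓ
    negative : ∀ {q} → q < 0ℚ → q ∈ cut
    downward : ∀ {p q} → p < q → q ∈ cut → p ∈ cut
    rounded  : ∀ {p} → p ∈ cut → ∃ λ q → p < q × q ∈ cut

open ℝ≥0∞ public

infix 4 _≤_ _≈_

_≤_ : ℝ≥0∞ → ℝ≥0∞ → Set
x ≤ y = cut x ⊆ cut y

_≈_ : ℝ≥0∞ → ℝ≥0∞ → Set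
x ≈ y = x ≤ y × y ≤ x

𝟘 : ℝ≥0∞
𝟘 .cut q        = q < 0ℚ
𝟘 .negative q<0 = q<0
𝟘 .downward     = <-trans
𝟘 .rounded p<0  = let q , p<q , q<0 = <-dense p<0 in q , p<q , q<0

∞ : ℝ≥0∞
∞ .cut _        = ⊤
∞ .negative _   = tt
∞ .downward _ _ = tt
∞ .rounded {p} _ = p + 1ℚ , subst (_< p + 1ℚ) (+-identityʳ p) (+-monoʳ-< p (positive⁻¹ 1ℚ)) , tt

-- A number below ∞ is one whose cut omits some rational.

record ℝ≥0 : Set₁ where
  field
    value  : ℝ≥0∞
    finite : ∃ λ q → q ∉ cut value

open ℝ≥0 public

0ᴿ : ℝ≥0
0ᴿ .value  = 𝟘
0ᴿ .finite = 0ℚ , <-irrefl refl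

infixl 6 _⊹_
infixl 7 _·_ _⊓_
infixl 6 _⊔ᴿ_

_⊹_ : ℝ≥0∞ → ℝ≥0∞ → ℝ≥0∞
(x ⊹ y) .cut q = ∃₂ λ a b → a ∈ cut x × b ∈ cut y × q < a + b
(x ⊹ y) .negative {q} q<0 =
  let a , q<a , a<0 = <-dense q<0
      q-a<0 = subst (q + - a <_) (+-inverseʳ a) (+-monoˡ-< (- a) q<a)
      b , q-a<b , b<0 = <-dense q-a<0
      a+[q-a]≡q = a+[p-a]≡p a q
  in a , b , negative x a<0 , negative y b<0
   , subst (_< a + b) a+[q-a]≡q (+-monoʳ-< a q-a<b)
  where
  a+[p-a]≡p : ∀ a q → a + (q + - a) ≡ q
  a+[p-a]≡p a q = trans (+-comm a (q + - a))
    (trans (+-assoc q (- a) a) (trans (cong (q +_) (+-inverseˡ a)) (+-identityʳ q)))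
(x ⊹ y) .downward p<q (a , b , a∈x , b∈y , q<a+b) = a , b , a∈x , b∈y , <-trans p<q q<a+b
(x ⊹ y) .rounded (a , b , a∈x , b∈y , p<a+b) =
  let q , p<q , q<a+b = <-dense p<a+b in q , p<q , a , b , a∈x , b∈y , q<a+b

-- If one factor is 𝟘, its cut has no positive member and the product is
-- 𝟘, even when the other factor is ∞.

_·_ : ℝ≥0 → ℝ≥0∞ → ℝ≥0∞
(t · x) .cut q =
  q < 0ℚ ⊎ ∃₂ λ a b → (0ℚ < a × a ∈ cut (value t)) × (0ℚ < b × b ∈ cut x) × q < a * b
(t · x) .negative = inj₁
(t · x) .downward p<q (inj₁ q<0) = inj₁ (<-trans p<q q<0)
(t · x) .downward p<q (inj₂ (a , b , a∈t , b∈x , q<ab)) =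
  inj₂ (a , b , a∈t , b∈x , <-trans p<q q<ab)
(t · x) .rounded (inj₁ p<0) = let q , p<q , q<0 = <-dense p<0 in q , p<q , inj₁ q<0
(t · x) .rounded (inj₂ (a , b , a∈t , b∈x , p<ab)) =
  let q , p<q , q<ab = <-dense p<ab in q , p<q , inj₂ (a , b , a∈t , b∈x , q<ab)

_⊓_ : ℝ≥0∞ → ℝ≥0∞ → ℝ≥0∞
(x ⊓ y) .cut = cut x ∩ cut y
(x ⊓ y) .negative q<0 = negative x q<0 , negative y q<0
(x ⊓ y) .downward p<q (q∈x , q∈y) = downward x p<q q∈x , downward y p<q q∈y
(x ⊓ y) .rounded (p∈x , p∈y) with rounded x p∈x | rounded y p∈y
... | a , p<a , a∈x | b , p<b , b∈y with <-cmp a b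
... | tri< a<b _ _  = a , p<a , a∈x , downward y a<b b∈y
... | tri≈ _ refl _ = a , p<a , a∈x , b∈y
... | tri> _ _ b<a  = b , p<b , downward x b<a a∈x , b∈y

_⊔ᴿ_ : ℝ≥0∞ → ℝ≥0∞ → ℝ≥0∞
(x ⊔ᴿ y) .cut = cut x ∪ cut y
(x ⊔ᴿ y) .negative q<0 = inj₁ (negative x q<0)
(x ⊔ᴿ y) .downward p<q (inj₁ q∈x) = inj₁ (downward x p<q q∈x)
(x ⊔ᴿ y) .downward p<q (inj₂ q∈y) = inj₂ (downward y p<q q∈y)
(x ⊔ᴿ y) .rounded (inj₁ p∈x) = let q , p<q , q∈x = rounded x p∈x in q , p<q , inj₁ q∈x
(x ⊔ᴿ y) .rounded (inj₂ p∈y) = let q , p<q , q∈y = rounded y p∈y in q , p<q , inj₂ q∈y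

∞⊹x≈∞ : ∀ x → ∞ ⊹ x ≈ ∞
∞⊹x≈∞ x = _ , λ {q} _ → q + (1ℚ + 1ℚ) , - 1ℚ , tt , negative x (toWitness {a? = - 1ℚ <? 0ℚ} tt)
  , subst (q <_) (sym (+-assoc q (1ℚ + 1ℚ) (- 1ℚ)))
      (subst (_< q + 1ℚ) (+-identityʳ q) (+-monoʳ-< q (positive⁻¹ 1ℚ)))

0·x≈0 : ∀ x → 0ᴿ · x ≈ 𝟘
0·x≈0 x = (λ { (inj₁ q<0) → q<0
             ; (inj₂ (_ , _ , (0<a , a<0) , _)) → contradiction (<-trans 0<a a<0) (<-irrefl refl) })
        , inj₁

r·∞≈∞ : ∀ r → 0ℚ ∈ cut (value r) → r · ∞ ≈ ∞
r·∞≈∞ r 0∈r = _ , λ {q} _ → large q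
  where
  large : ∀ q → q ∈ cut (r · ∞)
  large q with rounded (value r) 0∈r | <-cmp q 0ℚ
  ... | _             | tri< q<0 _ _ = inj₁ q<0
  ... | a , 0<a , a∈r | tri≈ _ refl _ =
    inj₂ (a , 1ℚ , (0<a , a∈r) , (positive⁻¹ 1ℚ , tt)
         , subst (0ℚ <_) (sym (*-identityʳ a)) 0<a)
  ... | a , 0<a , a∈r | tri> _ _ 0<q =
    inj₂ (a , 1/ a * (q + q) , (0<a , a∈r)
         , (positive⁻¹ _ {{pos*pos⇒pos (1/ a) (q + q)}} , tt)
         , subst (q <_) eq q<q+q)
    where
    instance
      a>0 = positive 0<a
      a≢0 = pos⇒nonZero a
      1/a>0 = 1/pos⇒pos a
    q<q+q : q < q + q
    q<q+q = subst (_< q + q) (+-identityʳ q) (+-monoʳ-< q 0<q)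
    instance
      q+q>0 = positive (<-trans 0<q q<q+q)
    eq : q + q ≡ a * (1/ a * (q + q))
    eq = sym (trans (sym (*-assoc a (1/ a) (q + q)))
           (trans (cong (_* (q + q)) (*-inverseʳ a)) (*-identityˡ (q + q))))

𝔼 : Set ℓ → Set (ℓ ⊔ lsuc 0ℓ)
𝔼 D = D → ℝ≥0∞

module _ {D : Set ℓ} where

  infix 4 _≤ᴱ_ _≈ᴱ_
  infixl 6 _+ᴱ_

  _≤ᴱ_ : 𝔼 D → 𝔼 D → Set ℓ
  η ≤ᴱ ξ = ∀ v → η v ≤ ξ v

  _≈ᴱ_ : 𝔼 D → 𝔼 D → Set ℓ
  η ≈ᴱ ξ = ∀ v → η v ≈ ξ v

  _+ᴱ_ : 𝔼 D → 𝔼 D → 𝔼 D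
  (η +ᴱ ξ) v = η v ⊹ ξ v

  record IsLeastFixedPoint (f : 𝔼 D → 𝔼 D) (μ : 𝔼 D) : Set (ℓ ⊔ lsuc 0ℓ) where
    field
      fixed : f μ ≈ᴱ μ
      least : ∀ ξ → f ξ ≈ᴱ ξ → μ ≤ᴱ ξ

data Extremum : Set where
  min max : Extremum

-- Formula min D is the grammar with min, Formula max D the one with max in
-- its place.  Expressions, terms and boolean conditions are represented by
-- the functions they denote.

data Formula (o : Extremum) (D : Set ℓ) : Set (ℓ ⊔ lsuc 0ℓ) where
  X[_] : (e : D → D) → Formula o D
  term : (t : D → ℝ≥0) → Formula o D
  _∔_  : (F₁ F₂ : Formula o D) → Formula o D
  _∙_  : (t : D → ℝ≥0) (F : Formula o D) → Formula o D
  ite  : (φ : D → Bool) (F₁ F₂ : Formula o D) → Formula o D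
  extr : (n : ℕ) (Fs : Vector (Formula o D) (suc n)) → Formula o D

extremum₂ : Extremum → ℝ≥0∞ → ℝ≥0∞ → ℝ≥0∞
extremum₂ min = _⊓_
extremum₂ max = _⊔ᴿ_

extremum : Extremum → Vector ℝ≥0∞ (suc n) → ℝ≥0∞
extremum {zero}  o xs = xs zero
extremum {suc n} o xs = extremum₂ o (xs zero) (extremum o (xs ∘ suc))

module _ {D : Set ℓ} where

  ⟦_⟧ : ∀ {o} → Formula o D → 𝔼 D → 𝔼 D
  ⟦ X[ e ] ⟧       η v = η (e v)
  ⟦ term t ⟧       η v = value (t v)
  ⟦ F₁ ∔ F₂ ⟧      η v = ⟦ F₁ ⟧ η v ⊹ ⟦ F₂ ⟧ η v
  ⟦ t ∙ F ⟧        η v = t v · ⟦ F ⟧ η v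
  ⟦ ite φ F₁ F₂ ⟧  η v = if φ v then ⟦ F₁ ⟧ η v else ⟦ F₂ ⟧ η v
  ⟦_⟧ {o} (extr n Fs) η v = extremum o (λ i → ⟦ Fs i ⟧ η v)

  infix 9 _ᵐᵃˣ

  _ᵐᵃˣ : Formula min D → Formula max D
  X[ e ]      ᵐᵃˣ = X[ e ]
  term t      ᵐᵃˣ = term t
  (F₁ ∔ F₂)   ᵐᵃˣ = (F₁ ᵐᵃˣ) ∔ (F₂ ᵐᵃˣ)
  (t ∙ F)     ᵐᵃˣ = t ∙ (F ᵐᵃˣ)
  ite φ F₁ F₂ ᵐᵃˣ = ite φ (F₁ ᵐᵃˣ) (F₂ ᵐᵃˣ)
  extr n Fs   ᵐᵃˣ = extr n (λ i → Fs i ᵐᵃˣ)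

  𝖣 : ∀ {o} → Formula o D → Formula o D
  𝖣 X[ e ]        = X[ e ]
  𝖣 (term t)      = term (λ _ → 0ᴿ)
  𝖣 (F₁ ∔ F₂)     = 𝖣 F₁ ∔ 𝖣 F₂
  𝖣 (t ∙ F)       = t ∙ 𝖣 F
  𝖣 (ite φ F₁ F₂) = ite φ (𝖣 F₁) (𝖣 F₂)
  𝖣 (extr n Fs)   = extr n (λ i → 𝖣 (Fs i))

-- Every ⟦ F ⟧ has a least fixed point, the supremum of its iterates from 0;
-- hence a quantification over least fixed points of ⟦ F ⟧ ranges over
-- exactly one element of 𝔼 D up to ≈ᴱ.

sup : (ℕ → ℝ≥0∞) → ℝ≥0∞
sup xs .cut q = ∃ λ n → q ∈ cut (xs n)
sup xs .negative q<0 = 0 , negative (xs 0) q<0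
sup xs .downward p<q (n , q∈x) = n , downward (xs n) p<q q∈x
sup xs .rounded (n , p∈x) = let q , p<q , q∈x = rounded (xs n) p∈x in q , p<q , n , q∈x

extremum-mono : ∀ o {xs ys : Vector ℝ≥0∞ (suc n)} →
                (∀ i → xs i ≤ ys i) → extremum o xs ≤ extremum o ys
extremum-mono {zero}  o   h q∈         = h zero q∈
extremum-mono {suc n} min h (p , q)    = h zero p , extremum-mono min (h ∘ suc) q
extremum-mono {suc n} max h (inj₁ p)   = inj₁ (h zero p)
extremum-mono {suc n} max h (inj₂ q)   = inj₂ (extremum-mono max (h ∘ suc) q)

Chain : (ℕ → ℝ≥0∞) → Set
Chain xs = ∀ {m n} → m ℕ.≤ n → xs m ≤ xs n

extremum-sup : ∀ o (xs : ℕ → Vector ℝ≥0∞ (suc n)) → (∀ i → Chain (λ k → xs k i)) →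
               extremum o (λ i → sup (λ k → xs k i)) ≤ sup (λ k → extremum o (xs k))
extremum-sup {zero}  o   xs c q∈ = q∈
extremum-sup {suc n} min xs c ((k , p) , q)
  with extremum-sup min (λ k → xs k ∘ suc) (c ∘ suc) q
... | l , q′ = k ℕ.⊔ l , c zero (ℕ.m≤m⊔n k l) p
             , extremum-mono min (λ i → c (suc i) (ℕ.m≤n⊔m k l)) q′
extremum-sup {suc n} max xs c (inj₁ (k , p)) = k , inj₁ p
extremum-sup {suc n} max xs c (inj₂ q)
  with extremum-sup max (λ k → xs k ∘ suc) (c ∘ suc) q
... | l , q′ = l , inj₂ q′

module _ {D : Set ℓ} {o : Extremum} where

  ⟦⟧-mono : ∀ (F : Formula o D) {η ξ} → η ≤ᴱ ξ → ⟦ F ⟧ η ≤ᴱ ⟦ F ⟧ ξ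
  ⟦⟧-mono X[ e ]    h v q∈ = h (e v) q∈
  ⟦⟧-mono (term t)  h v q∈ = q∈
  ⟦⟧-mono (F₁ ∔ F₂) h v (a , b , a∈ , b∈ , q<) = a , b , ⟦⟧-mono F₁ h v a∈ , ⟦⟧-mono F₂ h v b∈ , q<
  ⟦⟧-mono (t ∙ F)   h v (inj₁ q<0) = inj₁ q<0
  ⟦⟧-mono (t ∙ F)   h v (inj₂ (a , b , a∈ , (0<b , b∈) , q<)) =
    inj₂ (a , b , a∈ , (0<b , ⟦⟧-mono F h v b∈) , q<)
  ⟦⟧-mono (ite φ F₁ F₂) h v q∈ with φ v
  ... | true  = ⟦⟧-mono F₁ h v q∈
  ... | false = ⟦⟧-mono F₂ h v q∈
  ⟦⟧-mono (extr n Fs) h v q∈ = extremum-mono o (λ i → ⟦⟧-mono (Fs i) h v) q∈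

  ⟦⟧-sup : ∀ (F : Formula o D) (η : ℕ → 𝔼 D) → (∀ {m n} → m ℕ.≤ n → η m ≤ᴱ η n) →
           ⟦ F ⟧ (λ v → sup (λ k → η k v)) ≤ᴱ (λ v → sup (λ k → ⟦ F ⟧ (η k) v))
  ⟦⟧-sup X[ e ]    η c v q∈ = q∈
  ⟦⟧-sup (term t)  η c v q∈ = 0 , q∈
  ⟦⟧-sup (F₁ ∔ F₂) η c v (a , b , a∈ , b∈ , q<)
    with ⟦⟧-sup F₁ η c v a∈ | ⟦⟧-sup F₂ η c v b∈
  ... | k , a∈k | l , b∈l = k ℕ.⊔ l , a , b
      , ⟦⟧-mono F₁ (c (ℕ.m≤m⊔n k l)) v a∈k , ⟦⟧-mono F₂ (c (ℕ.m≤n⊔m k l)) v b∈l , q<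
  ⟦⟧-sup (t ∙ F)   η c v (inj₁ q<0) = 0 , inj₁ q<0
  ⟦⟧-sup (t ∙ F)   η c v (inj₂ (a , b , a∈ , (0<b , b∈) , q<)) with ⟦⟧-sup F η c v b∈
  ... | k , b∈k = k , inj₂ (a , b , a∈ , (0<b , b∈k) , q<)
  ⟦⟧-sup (ite φ F₁ F₂) η c v q∈ with φ v
  ... | true  = ⟦⟧-sup F₁ η c v q∈
  ... | false = ⟦⟧-sup F₂ η c v q∈
  ⟦⟧-sup (extr n Fs) η c v q∈ =
    extremum-sup o (λ k i → ⟦ Fs i ⟧ (η k) v) (λ i m≤n → ⟦⟧-mono (Fs i) (c m≤n) v)
      (extremum-mono o (λ i → ⟦⟧-sup (Fs i) η c v) q∈)

  leastFixedPoint : ∀ (F : Formula o D) → ∃ λ μ → IsLeastFixedPoint ⟦ F ⟧ μ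
  leastFixedPoint F = μ , record
    { fixed = λ v → (λ q∈ → let k , q∈k = ⟦⟧-sup F iter chain v q∈ in suc k , q∈k)
                  , (λ (k , q∈k) → ⟦⟧-mono F (λ w p∈ → k , p∈) v (chain (ℕ.n≤1+n k) v q∈k))
    ; least = λ ξ Fξ≈ξ v (k , q∈k) → below ξ Fξ≈ξ k v q∈k
    }
    where
    iter : ℕ → 𝔼 D
    iter zero    v = 𝟘
    iter (suc k) v = ⟦ F ⟧ (iter k) v

    chain : ∀ {m n} → m ℕ.≤ n → iter m ≤ᴱ iter n
    chain {n = n} z≤n v q<0 = negative (iter n v) q<0
    chain (s≤s m≤n) = ⟦⟧-mono F (chain m≤n)

    μ : 𝔼 D
    μ v = sup (λ k → iter k v)

    below : ∀ ξ → ⟦ F ⟧ ξ ≈ᴱ ξ → ∀ k → iter k ≤ᴱ ξ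
    below ξ Fξ≈ξ zero    v q<0 = negative (ξ v) q<0
    below ξ Fξ≈ξ (suc k) v q∈  = proj₁ (Fξ≈ξ v) (⟦⟧-mono F (below ξ Fξ≈ξ k) v q∈)

-- Write D for ⟦ 𝖣 (F ᵐᵃˣ) ⟧.  Increments of ⟦ F ⟧ are controlled by D, that is
-- ⟦ F ⟧ (μ + δ) ≤ ⟦ F ⟧ μ + D δ, and D is positively homogeneous.  Hence
-- η ≤ μ + r/n gives η ≤ ⟦ F ⟧ η ≤ ⟦ F ⟧ (μ + r/n) ≤ μ + (D r)/n.  Adding n times
-- this to η ≤ u yields (n+1) η ≤ n μ + D r + u ≤ (n+1) μ + r, so that
-- η ≤ μ + r/(n+1).  The induction starts at η ≤ u ≤ r, and since r is finite
-- everywhere, letting n grow gives η ≤ μ.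

{-# OPTIONS --safe #-}
module Submission where

open import Data.Bool using (true; false)
open import Data.Fin using (zero; suc)
import Data.Integer as ℤ
import Data.Integer.Properties as ℤ
open import Data.Nat as ℕ using (ℕ; zero; suc)
import Data.Nat.Properties as ℕ
open import Data.Product using (∃; _×_; _,_; proj₁; proj₂)
open import Data.Rational as ℚ using
  (ℚ; mkℚ; 0ℚ; 1ℚ; _<_; _+_; _*_; -_; positive; 1/_; Positive; toℚᵘ)
open import Data.Rational.Properties as ℚ using
  ( <-trans; <-dense; <-≤-trans; ≮⇒≥; _<?_; +-comm; +-identityˡ; +-inverseʳ
  ; +-monoˡ-<; +-monoʳ-<; +-monoˡ-≤; *-zeroˡ; *-zeroʳ; *-identityʳ; *-inverseʳ
  ; *-monoˡ-<-pos; *-monoʳ-<-pos; *-monoˡ-≤-nonNeg; *-monoʳ-≤-nonNeg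
  ; pos⇒nonZero; pos⇒nonNeg; 1/pos⇒pos; pos+pos⇒pos
  ; toℚᵘ-cancel-≤; toℚᵘ-homo-+ )
open import Data.Rational.Solver using (module +-*-Solver)
open import Data.Rational.Unnormalised as ℚᵘ using (mkℚᵘ; *≡*; *≤*)
import Data.Rational.Unnormalised.Properties as ℚᵘ
open import Data.Sum using (inj₁; inj₂)
open import Data.Vec.Functional using (Vector)
open import Level using (Level)
open import Function using (_∘_)
open import Relation.Binary.PropositionalEquality using (_≡_; refl; sym; trans; cong; subst; subst₂)
open import Relation.Nullary using (yes; no)
open import Relation.Nullary.Negation using (contradiction)
open import Relation.Unary using (_∈_)
open import Defs

open +-*-Solver using (solve; _:=_; _:+_; _:*_; :-_; con)

-- Inequalities for sums, products and minima of cuts.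

-- Nested sums and products demand strict inequalities at each level; the slack in `q < a + b` is
-- shared out by lowering one summand.
<+⇒<-shrinkˡ : ∀ {q a b} → q < a + b → ∃ λ a′ → a′ < a × q < a′ + b
<+⇒<-shrinkˡ {q} {a} {b} q<a+b =
  let a′ , q-b<a′ , a′<a = <-dense q-b<a
  in a′ , a′<a , subst (_< a′ + b) (p-s+s≡p q b) (+-monoˡ-< b q-b<a′)
  where
  p-s+s≡p : ∀ p s → p + - s + s ≡ p
  p-s+s≡p = solve 2 (λ p s → p :+ :- s :+ s := p) refl
  p+s-s≡p : ∀ p s → p + s + - s ≡ p
  p+s-s≡p = solve 2 (λ p s → p :+ s :+ :- s := p) refl
  q-b<a : q + - b < a
  q-b<a = subst (q + - b <_) (p+s-s≡p a b) (+-monoˡ-< (- b) q<a+b)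

<+⇒<-shrinkʳ : ∀ {q a b} → q < a + b → ∃ λ b′ → b′ < b × q < a + b′
<+⇒<-shrinkʳ {q} {a} {b} q<a+b =
  let b′ , b′<b , q<b′+a = <+⇒<-shrinkˡ (subst (q <_) (+-comm a b) q<a+b)
  in b′ , b′<b , subst (q <_) (+-comm b′ a) q<b′+a

downward-≤ : ∀ x {p q} → p ℚ.≤ q → q ∈ cut x → p ∈ cut x
downward-≤ x p≤q q∈x = let r , q<r , r∈x = rounded x q∈x in downward x (ℚ.≤-<-trans p≤q q<r) r∈x

-- Roundedness leaves room for a slightly negative summand, and every cut contains the negative
-- rationals.
x≤y⊹x : ∀ x y → x ≤ y ⊹ x
x≤y⊹x x y {q} q∈x =
  let p , q<p , p∈x = rounded x q∈x
      s , s<0 , q<s+p = <+⇒<-shrinkˡ (subst (q <_) (sym (+-identityˡ p)) q<p)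
  in s , p , negative y s<0 , p∈x , q<s+p

⊹-comm-≤ : ∀ x y → x ⊹ y ≤ y ⊹ x
⊹-comm-≤ x y {q} (a , b , a∈x , b∈y , q<a+b) = b , a , b∈y , a∈x , subst (q <_) (+-comm a b) q<a+b

⊹-interchange-≤ : ∀ x y z w → (x ⊹ y) ⊹ (z ⊹ w) ≤ (x ⊹ z) ⊹ (y ⊹ w)
⊹-interchange-≤ x y z w {q} (s , t , (a , b , a∈x , b∈y , s<a+b) , (c , d , c∈z , d∈w , t<c+d) , q<s+t) =
  let a+c , a+c< , q<ˡ = <+⇒<-shrinkˡ (subst (q <_) (eq a b c d) (<-trans q<s+t (ℚ.+-mono-< s<a+b t<c+d)))
      b+d , b+d< , q<ʳ = <+⇒<-shrinkʳ {a = a+c} q<ˡ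
  in a+c , b+d , (a , c , a∈x , c∈z , a+c<) , (b , d , b∈y , d∈w , b+d<) , q<ʳ
  where
  eq : ∀ a b c d → (a + b) + (c + d) ≡ (a + c) + (b + d)
  eq = solve 4 (λ a b c d → (a :+ b) :+ (c :+ d) := (a :+ c) :+ (b :+ d)) refl

-- The product cut admits only positive `b` as a factor; for `b ≤ 0` the bound forces `p < 0`, which
-- is a member anyway.
·-member : ∀ t x {p a b} → 0ℚ < a → a ∈ cut (value t) → b ∈ cut x → p < a * b → p ∈ cut (t · x)
·-member t x {p} {a} {b} 0<a a∈t b∈x p<ab with 0ℚ <? b
... | yes 0<b = inj₂ (a , b , (0<a , a∈t) , (0<b , b∈x) , p<ab)
... | no  0≮b = inj₁ (<-≤-trans p<ab (subst (a * b ℚ.≤_) (*-zeroʳ a) (*-monoˡ-≤-nonNeg a (≮⇒≥ 0≮b))))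
  where
  instance
    a>0 = positive 0<a
    a≥0 = pos⇒nonNeg a

·-distribˡ-⊹-≤ : ∀ t x y → t · (x ⊹ y) ≤ t · x ⊹ t · y
·-distribˡ-⊹-≤ t x y (inj₁ q<0) = negative (t · x ⊹ t · y) q<0
·-distribˡ-⊹-≤ t x y {q} (inj₂ (a , s , (0<a , a∈t) , (_ , b , c , b∈x , c∈y , s<b+c) , q<as)) =
  let ab , ab< , q<ˡ = <+⇒<-shrinkˡ (subst (q <_) (ℚ.*-distribˡ-+ a b c) (<-trans q<as (*-monoʳ-<-pos a s<b+c)))
      ac , ac< , q<ʳ = <+⇒<-shrinkʳ {a = ab} q<ˡ
  -- Only `s` is known to be positive; `b` or `c` may fail to be, hence `·-member`.
  in ab , ac , ·-member t x 0<a a∈t b∈x ab< , ·-member t y 0<a a∈t c∈y ac< , q<ʳ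
  where
  instance
    a>0 = positive 0<a

-- The smaller of `a` and `c` lies in both first cuts by downward closure, and its partner lies in
-- one of the cuts of `y` and `w`, hence in their maximum.
⊓-⊹-≤ : ∀ x y z w → (x ⊹ y) ⊓ (z ⊹ w) ≤ (x ⊓ z) ⊹ (y ⊔ᴿ w)
⊓-⊹-≤ x y z w ((a , b , a∈x , b∈y , q<a+b) , (c , d , c∈z , d∈w , q<c+d)) with a <? c
... | yes a<c = a , b , (a∈x , downward z a<c c∈z) , inj₁ b∈y , q<a+b
... | no  a≮c = c , d , (downward-≤ x (≮⇒≥ a≮c) a∈x , c∈z) , inj₂ d∈w , q<c+d

extremum-min-⊹ : ∀ {n} (xs ys : Vector ℝ≥0∞ (suc n)) →
                 extremum min (λ i → xs i ⊹ ys i) ≤ extremum min xs ⊹ extremum max ys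
extremum-min-⊹ {zero}  xs ys q∈ = q∈
extremum-min-⊹ {suc n} xs ys (p , q) =
  ⊓-⊹-≤ (xs zero) (ys zero) (extremum min (xs ∘ suc)) (extremum max (ys ∘ suc))
    (p , extremum-min-⊹ (xs ∘ suc) (ys ∘ suc) q)

-- Increments of a formula.

module _ {ℓ : Level} {D : Set ℓ} where

  -- By induction on `F`. A minimum of sums is bounded by the minimum of the values plus the maximum
  -- of the increments, which is why `𝖣` is taken of `F ᵐᵃˣ`.
  ⟦⟧-increment : ∀ (F : Formula min D) η δ → ⟦ F ⟧ (η +ᴱ δ) ≤ᴱ ⟦ F ⟧ η +ᴱ ⟦ 𝖣 (F ᵐᵃˣ) ⟧ δ
  ⟦⟧-increment X[ e ]    η δ v q∈ = q∈
  ⟦⟧-increment (term t)  η δ v q∈ = ⊹-comm-≤ 𝟘 (value (t v)) (x≤y⊹x (value (t v)) 𝟘 q∈)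
  ⟦⟧-increment (F₁ ∔ F₂) η δ v (a , b , a∈ , b∈ , q<) =
    ⊹-interchange-≤ (⟦ F₁ ⟧ η v) (⟦ 𝖣 (F₁ ᵐᵃˣ) ⟧ δ v) (⟦ F₂ ⟧ η v) (⟦ 𝖣 (F₂ ᵐᵃˣ) ⟧ δ v)
      (a , b , ⟦⟧-increment F₁ η δ v a∈ , ⟦⟧-increment F₂ η δ v b∈ , q<)
  ⟦⟧-increment (t ∙ F)   η δ v (inj₁ q<0) =
    negative (t v · ⟦ F ⟧ η v ⊹ t v · ⟦ 𝖣 (F ᵐᵃˣ) ⟧ δ v) q<0
  ⟦⟧-increment (t ∙ F)   η δ v (inj₂ (a , b , a∈ , (0<b , b∈) , q<)) =
    ·-distribˡ-⊹-≤ (t v) (⟦ F ⟧ η v) (⟦ 𝖣 (F ᵐᵃˣ) ⟧ δ v)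
      (inj₂ (a , b , a∈ , (0<b , ⟦⟧-increment F η δ v b∈) , q<))
  ⟦⟧-increment (ite φ F₁ F₂) η δ v q∈ with φ v
  ... | true  = ⟦⟧-increment F₁ η δ v q∈
  ... | false = ⟦⟧-increment F₂ η δ v q∈
  ⟦⟧-increment (extr n Fs) η δ v q∈ =
    extremum-min-⊹ (λ i → ⟦ Fs i ⟧ η v) (λ i → ⟦ 𝖣 (Fs i ᵐᵃˣ) ⟧ δ v)
      (extremum-mono min (λ i → ⟦⟧-increment (Fs i) η δ v) q∈)

-- Division by a positive rational.

infixl 7 _÷_

-- As `c` is positive, `q < x/c` amounts to `q * c < x`.
_÷_ : ℝ≥0∞ → (c : ℚ) .{{_ : Positive c}} → ℝ≥0∞
(x ÷ c) .cut q = q * c ∈ cut x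
(x ÷ c) .negative {q} q<0 = negative x (subst (q * c <_) (*-zeroˡ c) (*-monoˡ-<-pos c q<0))
(x ÷ c) .downward p<q q∈x = downward x (*-monoˡ-<-pos c p<q) q∈x
(x ÷ c) .rounded {p} pc∈x =
  let s , pc<s , s∈x = rounded x pc∈x
  in s * w , subst (_< s * w) (pcw≡p p) (*-monoˡ-<-pos w pc<s) , subst (_∈ cut x) (sym (swc≡s s)) s∈x
  where
  instance
    c≢0 = pos⇒nonZero c
    1/c>0 = 1/pos⇒pos c
  w = 1/ c
  pcw≡p : ∀ p → p * c * w ≡ p
  pcw≡p p = trans (ℚ.*-assoc p c w) (trans (cong (p *_) (*-inverseʳ c)) (*-identityʳ p))
  swc≡s : ∀ s → s * w * c ≡ s
  swc≡s s = trans (ℚ.*-assoc s w c) (trans (cong (s *_) (ℚ.*-inverseˡ c)) (*-identityʳ s))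

module _ (c : ℚ) .{{c>0 : Positive c}} where

  extremum-÷ : ∀ {n} o (xs : Vector ℝ≥0∞ (suc n)) → extremum o (λ i → xs i ÷ c) ≤ extremum o xs ÷ c
  extremum-÷ {zero}  o   xs q∈       = q∈
  extremum-÷ {suc n} min xs (p , q)  = p , extremum-÷ min (xs ∘ suc) q
  extremum-÷ {suc n} max xs (inj₁ p) = inj₁ p
  extremum-÷ {suc n} max xs (inj₂ q) = inj₂ (extremum-÷ max (xs ∘ suc) q)

  -- `𝖣` turns every additive constant into 0, which scaling preserves; the remaining operations
  -- commute with scaling.
  𝖣-÷ : ∀ {ℓ} {D : Set ℓ} {o} (F : Formula o D) δ →
        ⟦ 𝖣 F ⟧ (λ v → δ v ÷ c) ≤ᴱ (λ v → ⟦ 𝖣 F ⟧ δ v ÷ c)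
  𝖣-÷ X[ e ]    δ v q∈ = q∈
  𝖣-÷ (term t)  δ v q<0 = negative (𝟘 ÷ c) q<0
  𝖣-÷ (F₁ ∔ F₂) δ v {q} (a , b , a∈ , b∈ , q<a+b) =
    a * c , b * c , 𝖣-÷ F₁ δ v a∈ , 𝖣-÷ F₂ δ v b∈
    , subst (q * c <_) (ℚ.*-distribʳ-+ c a b) (*-monoˡ-<-pos c q<a+b)
  𝖣-÷ (t ∙ F)   δ v (inj₁ q<0) = negative ((t v · ⟦ 𝖣 F ⟧ δ v) ÷ c) q<0
  𝖣-÷ (t ∙ F)   δ v {q} (inj₂ (a , b , (0<a , a∈) , (_ , b∈) , q<ab)) =
    ·-member (t v) (⟦ 𝖣 F ⟧ δ v) 0<a a∈ (𝖣-÷ F δ v b∈)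
      (subst (q * c <_) (ℚ.*-assoc a b c) (*-monoˡ-<-pos c q<ab))
  𝖣-÷ (ite φ F₁ F₂) δ v q∈ with φ v
  ... | true  = 𝖣-÷ F₁ δ v q∈
  ... | false = 𝖣-÷ F₂ δ v q∈
  𝖣-÷ {o = o} (extr n Fs) δ v q∈ =
    extremum-÷ o (λ i → ⟦ 𝖣 (Fs i) ⟧ δ v) (extremum-mono o (λ i → 𝖣-÷ (Fs i) δ v) q∈)

  -- x ≤ z + d/c and x ≤ y imply (c+1) x ≤ c z + (d + y), stated with the
  -- factor c+1 divided out and c z enlarged to (c+1) z.
  ÷-step : ∀ {x y z d r} .{{_ : Positive (c + 1ℚ)}} → x ≤ y → d ⊹ y ≤ r →
           x ≤ z ⊹ d ÷ c → x ≤ z ⊹ r ÷ (c + 1ℚ)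
  ÷-step {x} {y} {z} {d} {r} x≤y d+y≤r x≤z+d/c {q} q∈x =
    let q′ , q<q′ , q′∈x = rounded x q∈x
        a , b , a∈z , bc∈d , q′<a+b = x≤z+d/c q′∈x
        bc+q∈r = d+y≤r (b * c , q′ , bc∈d , x≤y q′∈x , +-monoʳ-< (b * c) q<q′)
    -- From `q < a + b` follows `q * c + q < a * c + (b * c + q)`; multiplying by `w`, the inverse
    -- of `c + 1`, yields the two summands.
    in a * c * w , (b * c + q) * w , shrink a a∈z
     , subst (_∈ cut r) (sym (sw[c+1]≡s (b * c + q))) bc+q∈r
     , subst₂ _<_ (lhs q) (rhs q a b)
         (*-monoˡ-<-pos w (+-monoˡ-< q (*-monoˡ-<-pos c (<-trans q<q′ q′<a+b))))
    where
    instance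
      c+1≢0 = pos⇒nonZero (c + 1ℚ)
      w>0 = 1/pos⇒pos (c + 1ℚ)
      c≥0 = pos⇒nonNeg c
      w≥0 = pos⇒nonNeg (1/ (c + 1ℚ))
    w = 1/ (c + 1ℚ)
    s[c+1]w≡s : ∀ s → s * (c + 1ℚ) * w ≡ s
    s[c+1]w≡s s = trans (ℚ.*-assoc s (c + 1ℚ) w)
      (trans (cong (s *_) (*-inverseʳ (c + 1ℚ))) (*-identityʳ s))
    sw[c+1]≡s : ∀ s → s * w * (c + 1ℚ) ≡ s
    sw[c+1]≡s s = trans (ℚ.*-assoc s w (c + 1ℚ))
      (trans (cong (s *_) (ℚ.*-inverseˡ (c + 1ℚ))) (*-identityʳ s))
    sc+s≡s[c+1] : ∀ s → s * c + s ≡ s * (c + 1ℚ)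
    sc+s≡s[c+1] s = solve 2 (λ s c → s :* c :+ s := s :* (c :+ con 1ℚ)) refl s c
    lhs : ∀ q → (q * c + q) * w ≡ q
    lhs q = trans (cong (_* w) (sc+s≡s[c+1] q)) (s[c+1]w≡s q)
    rhs : ∀ q a b → ((a + b) * c + q) * w ≡ a * c * w + (b * c + q) * w
    rhs q a b = solve 5 (λ a b c q w →
      ((a :+ b) :* c :+ q) :* w := a :* c :* w :+ (b :* c :+ q) :* w) refl a b c q w
    -- The factor `c * w` is c/(c+1), between 0 and 1: it keeps a negative `a` negative and does not
    -- increase a nonnegative one.
    shrink : ∀ a → a ∈ cut z → a * c * w ∈ cut z
    shrink a a∈z with a <? 0ℚ
    ... | yes a<0 = negative z (subst (a * c * w <_) (trans (cong (_* w) (*-zeroˡ c)) (*-zeroˡ w))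
                      (*-monoˡ-<-pos w (*-monoˡ-<-pos c a<0)))
    ... | no  a≮0 = downward-≤ z (subst (a * c * w ℚ.≤_) (lhs a) (*-monoʳ-≤-nonNeg w ac≤ac+a)) a∈z
      where
      ac≤ac+a : a * c ℚ.≤ a * c + a
      ac≤ac+a = subst (ℚ._≤ a * c + a) (ℚ.+-identityʳ (a * c)) (ℚ.+-monoʳ-≤ (a * c) (≮⇒≥ a≮0))

-- Division by n + 1, its limit, and the induction.

-- fromℕ⁺ n represents n + 1.
fromℕ⁺ : ℕ → ℚ
fromℕ⁺ zero    = 1ℚ
fromℕ⁺ (suc n) = fromℕ⁺ n + 1ℚ

fromℕ⁺-pos : ∀ n → Positive (fromℕ⁺ n)
fromℕ⁺-pos zero    = _
fromℕ⁺-pos (suc n) = pos+pos⇒pos (fromℕ⁺ n) {{fromℕ⁺-pos n}} 1ℚ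

infixl 7 _÷⁺_

_÷⁺_ : ℝ≥0∞ → ℕ → ℝ≥0∞
x ÷⁺ n = (x ÷ fromℕ⁺ n) {{fromℕ⁺-pos n}}

toℚᵘ-fromℕ⁺ : ∀ n → toℚᵘ (fromℕ⁺ n) ℚᵘ.≃ mkℚᵘ (ℤ.+ suc n) 0
toℚᵘ-fromℕ⁺ zero    = ℚᵘ.≃-refl
toℚᵘ-fromℕ⁺ (suc n) = ℚᵘ.≃-trans (toℚᵘ-homo-+ (fromℕ⁺ n) 1ℚ)
  (ℚᵘ.≃-trans (ℚᵘ.+-congˡ _ (toℚᵘ-fromℕ⁺ n)) (*≡* (cong ℤ.+_ (eq n))))
  where
  eq : ∀ n → (suc n ℕ.* 1 ℕ.+ 1) ℕ.* 1 ≡ suc (suc n) ℕ.* 1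
  eq n = cong (ℕ._* 1) (trans (ℕ.+-comm (suc n ℕ.* 1) 1) (cong suc (ℕ.*-identityʳ (suc n))))

≤-fromℕ⁺ : ∀ p → ∃ λ n → p ℚ.≤ fromℕ⁺ n
-- The denominator `suc d` is at least 1, so the fraction is at most the absolute value of its
-- numerator.
≤-fromℕ⁺ p@(mkℚ m d _) = ℤ.∣ m ∣ , toℚᵘ-cancel-≤
  (ℚᵘ.≤-respʳ-≃ (ℚᵘ.≃-sym (toℚᵘ-fromℕ⁺ ℤ.∣ m ∣)) (*≤* (bound m)))
  where
  bound : ∀ m → m ℤ.* ℤ.+ 1 ℤ.≤ ℤ.+ suc ℤ.∣ m ∣ ℤ.* ℤ.+ suc d
  bound (ℤ.+ k) rewrite ℤ.*-identityʳ (ℤ.+ k) =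
    ℤ.+≤+ (ℕ.≤-trans (ℕ.n≤1+n k) (ℕ.m≤m*n (suc k) (suc d)))
  bound ℤ.-[1+ k ] = ℤ.-≤+

archimedean : ∀ {e} M → 0ℚ < e → ∃ λ n → M ℚ.≤ e * fromℕ⁺ n
archimedean {e} M 0<e =
  let n , 1/eM≤n = ≤-fromℕ⁺ (1/ e * M)
  in n , subst (ℚ._≤ e * fromℕ⁺ n) e[1/eM]≡M (*-monoˡ-≤-nonNeg e 1/eM≤n)
  where
  instance
    e>0 = positive 0<e
    e≢0 = pos⇒nonZero e
    e≥0 = pos⇒nonNeg e
  e[1/eM]≡M : e * (1/ e * M) ≡ M
  e[1/eM]≡M = trans (sym (ℚ.*-assoc e (1/ e) M)) (trans (cong (_* M) (*-inverseʳ e)) (ℚ.*-identityˡ M))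

-- A rational omitted by the cut of `r` bounds `r`, so for large `n` the term `value r ÷⁺ n` is at
-- most the gap `q′ + - q`; the part coming from `z` must then exceed `q`.
≤-⊹÷⁺-limit : ∀ x z (r : ℝ≥0) → (∀ n → x ≤ z ⊹ value r ÷⁺ n) → x ≤ z
≤-⊹÷⁺-limit x z r x≤z+r/n {q} q∈x with rounded x q∈x
... | q′ , q<q′ , q′∈x
  with archimedean (proj₁ (finite r)) (subst (_< q′ + - q) (+-inverseʳ q) (+-monoˡ-< (- q) q<q′))
... | n , M≤[q′-q]n with x≤z+r/n n q′∈x
... | a , b , a∈z , bn∈r , q′<a+b with q <? a
... | yes q<a = downward z q<a a∈z
-- Here `a ≤ q` forces `b` above the gap, so `b * fromℕ⁺ n` is at least the omitted rational, yet
-- lies in the cut of `r`.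
... | no  q≮a = contradiction
  (downward-≤ (value r) (ℚ.≤-trans M≤[q′-q]n (*-monoʳ-≤-nonNeg (fromℕ⁺ n) (ℚ.<⇒≤ q′-q<b))) bn∈r)
  (proj₂ (finite r))
  where
  instance
    n≥0 = pos⇒nonNeg (fromℕ⁺ n) {{fromℕ⁺-pos n}}
  q′-q<b : q′ + - q < b
  q′-q<b = subst (q′ + - q <_) (solve 2 (λ q b → q :+ b :+ :- q := b) refl q b)
    (+-monoˡ-< (- q) (<-≤-trans q′<a+b (+-monoˡ-≤ b (≮⇒≥ q≮a))))

theoremE4 : ∀ {ℓ : Level} {D : Set ℓ} (F : Formula min D)
    (u : 𝔼 D) → ⟦ F ᵐᵃˣ ⟧ u ≤ᴱ u →
    (r : D → ℝ≥0) → ⟦ 𝖣 (F ᵐᵃˣ) ⟧ (value ∘ r) +ᴱ u ≤ᴱ value ∘ r →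
    (η : 𝔼 D) → η ≤ᴱ u → η ≤ᴱ ⟦ F ⟧ η →
    (μ : 𝔼 D) → IsLeastFixedPoint ⟦ F ⟧ μ → η ≤ᴱ μ
theoremE4 {D = D} F u _ r Dr+u≤r η η≤u η≤Fη μ μ-lfp v =
  ≤-⊹÷⁺-limit (η v) (μ v) (r v) (λ n → η≤μ+r/n n v)
  where
  Dr : 𝔼 D
  Dr = ⟦ 𝖣 (F ᵐᵃˣ) ⟧ (value ∘ r)

  r/ : ℕ → 𝔼 D
  -- The divisor is n + 1, so `r/ 0` is `r` divided by 1 and the induction can start at index 0.
  r/ n v = value (r v) ÷⁺ n

  improve : ∀ n → η ≤ᴱ μ +ᴱ r/ n → ∀ v → η v ≤ μ v ⊹ Dr v ÷⁺ n
  improve n η≤μ+r/n v q∈ =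
    let a , b , a∈Fμ , b∈D , q<a+b = ⟦⟧-increment F μ (r/ n) v (⟦⟧-mono F η≤μ+r/n v (η≤Fη v q∈))
    in a , b , proj₁ (IsLeastFixedPoint.fixed μ-lfp v) a∈Fμ
     , 𝖣-÷ (fromℕ⁺ n) {{fromℕ⁺-pos n}} (F ᵐᵃˣ) (value ∘ r) v b∈D , q<a+b

  η≤μ+r/n : ∀ n → η ≤ᴱ μ +ᴱ r/ n
  -- The start needs only `η ≤ u ≤ Dr + u ≤ r`; the summand `μ` is added on the left.
  η≤μ+r/n zero v {q} q∈ = x≤y⊹x (r/ 0 v) (μ v)
    (subst (_∈ cut (value (r v))) (sym (*-identityʳ q))
      (Dr+u≤r v (x≤y⊹x (u v) (Dr v) (η≤u v q∈))))
  η≤μ+r/n (suc n) v =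
    ÷-step (fromℕ⁺ n) {{fromℕ⁺-pos n}} {η v} {u v} {μ v} {Dr v} {value (r v)} {{fromℕ⁺-pos (suc n)}}
      (η≤u v) (Dr+u≤r v) (improve n (η≤μ+r/n n) v)
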